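{- Let $m \in \mathbb{N}$ with $m > 2$. For integers $n \geq 2$ and $m \geq 3$, let $J_{n,m}$ denote the Jahangir graph and let $\sigma(J_{n,m})$ denote its number of spanning trees. Then $$\lim_{n \to \infty} \frac{\sigma(J_{n,m})}{\sigma(J_{n-1,m})} = 1.$$
   Context: For integers $n \geq 2$ and $m \geq 3$, the Jahangir graph $J_{n,m}$ is the simple graph on $nm+1$ vertices consisting of a cycle $C_{nm}$ on $nm$ vertices together with one additional (central) vertex that is adjacent to exactly $m$ vertices of $C_{nm}$, these $m$ vertices being at distance $n$ from each other along $C_{nm}$. A spanning tree of a finite simple connected graph $\mathcal{G}$ is a connected acyclic subgraph containing every vertex of $\mathcal{G}$; $\sigma(\mathcal{G})$ denotes the number of spanning trees of $\mathcal{G}$. In the limit, $n$ ranges over integers $n \geq 3$, so that both $J_{n,m}$ and $J_{n-1,m}$ are defined. -}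

module Defs where

open import Data.Nat using (ℕ; zero; suc; _+_; _*_; _∸_; _≡ᵇ_)
open import Data.Nat.DivMod using (_%_)
open import Data.Bool using (Bool; true; false; _∧_; _∨_; not; if_then_else_)
open import Data.List using (List; []; _∷_; map; _++_; length; filter; upTo; foldr)
open import Data.Bool.ListAction using (all; any)
open import Data.Product using (_×_; _,_; proj₁; proj₂)
open import Data.Integer using (+_)
open import Data.Rational using (ℚ; _/_; 0ℚ)
open import Relation.Nullary.Decidable using (Dec)
open import Data.Bool.Properties using (T?)
open import Data.Bool using (T)

-- Finite simple graphs: vertex set {0, …, V-1} (V : ℕ) together with a
-- list of edges; each edge is an unordered pair, stored as (u , v).
-- A spanning subgraph is given by a sublist (subset of positions) of
-- the edge list.

Edge : Set
Edge = ℕ × ℕ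

record Graph : Set where
  constructor mkGraph
  field
    nV    : ℕ          -- vertices are 0 … nV-1
    edges : List Edge

open Graph public

elem : ℕ → List ℕ → Bool
elem x xs = any (x ≡ᵇ_) xs

step : List Edge → List ℕ → List ℕ
step es R = R ++ foldr (λ e acc → (if elem (proj₁ e) R then proj₂ e ∷ [] else [])
                                  ++ (if elem (proj₂ e) R then proj₁ e ∷ [] else [])
                                  ++ acc) [] es

iter : ℕ → (List ℕ → List ℕ) → List ℕ → List ℕ
iter zero    f x = x
iter (suc k) f x = iter k f (f x)

-- `connectedIn V es u v` : there is a walk from u to v using edges of es
-- (walks of length < V suffice on V vertices, so V closure steps are enough)
connectedIn : ℕ → List Edge → ℕ → ℕ → Bool
connectedIn V es u v = elem v (iter V (step es) (u ∷ []))

picks : {A : Set} → List A → List (A × List A)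
picks []       = []
picks (x ∷ xs) = (x , xs) ∷ map (λ p → proj₁ p , x ∷ proj₂ p) (picks xs)

sublists : {A : Set} → List A → List (List A)
sublists []       = [] ∷ []
sublists (x ∷ xs) = map (x ∷_) (sublists xs) ++ sublists xs

isConnected : ℕ → List Edge → Bool
isConnected V T = all (λ v → connectedIn V T 0 v) (upTo V)

-- the spanning subgraph (V, T) is acyclic: no edge of T lies on a cycle,
-- i.e. for each edge uv of T, u and v are not joined by a walk in T - uv
isAcyclic : ℕ → List Edge → Bool
isAcyclic V T = all (λ p → not (connectedIn V (proj₂ p) (proj₁ (proj₁ p)) (proj₂ (proj₁ p))))
                    (picks T)

isSpanningTree : ℕ → List Edge → Bool
isSpanningTree V T = isConnected V T ∧ isAcyclic V T

σ : Graph → ℕ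
σ G = length (filter (λ T → T? (isSpanningTree (nV G) T)) (sublists (edges G)))

-- Jahangir graph J_{n,m}: cycle C_{nm} on vertices 0 … nm-1 (edges
-- i — (i+1) mod nm), plus central vertex nm adjacent to the m cycle
-- vertices 0, n, 2n, …, (m-1)n (pairwise at distance n along the cycle).
-- Intended for n ≥ 2, m ≥ 3 (then nm ≥ 6, so the graph is simple).

cycleEdges : ℕ → List Edge
cycleEdges N = map (λ i → i , (suc i) % suc (N ∸ 1)) (upTo N)

Jahangir : ℕ → ℕ → Graph
Jahangir n m = mkGraph (suc (n * m))
                       (cycleEdges (n * m) ++ map (λ k → n * m , n * k) (upTo m))

-- ratio a / b as a rational (with the harmless convention a/0 = 0,
-- never used here since Jahangir graphs are connected, so σ > 0)
ratio : ℕ → ℕ → ℚ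
ratio a zero    = 0ℚ
ratio a (suc b) = (+ a) / suc b

{-# OPTIONS --safe #-}

-- A connected graph is a tree iff deleting any edge disconnects it, so everything reduces to
-- connectivity of edge sets of J(n,m).  Cut the rim into m paths of n edges between consecutive
-- spoke vertices.  Scanning the rim once, an edge set is connected iff some spoke is present and
-- any two missing rim edges are separated by a spoke on both sides; hence whether it is a
-- spanning tree depends only on the spokes and on the number of edges missing from each path,
-- which must be 0 or 1.  A path with one edge missing can be realised in n ways, so σ(J(n,m)) is
-- a polynomial in n, of degree at most m, with natural coefficients independent of n, and
-- nonzero because the star of all spokes with every path cut counts.  For such a polynomial P,
-- P(p) ≤ P(p + 1) ≤ (1 + g/p) P(p) with g depending only on m.

module Submission where

open import Defs
open import Data.Bool using (Bool; true; false; T; if_then_else_; not; _∧_; _∨_)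
open import Data.Bool.ListAction using (all)
open import Data.Bool.Properties using (∧-assoc; ⇔→≡; T-≡; T?)
open import Data.Empty using (⊥-elim)
import Data.Integer as ℤ
import Data.Integer.Properties as ℤ
open import Data.List as List using (List; []; _∷_; _++_; map; foldr; filter; length; upTo; applyUpTo)
open import Data.List.Membership.Propositional using (_∈_)
open import Data.List.Membership.Propositional.Properties using (∈-++⁺ˡ; ∈-++⁺ʳ; ∈-++⁻; ∈-upTo⁺; ∈-upTo⁻; ∈-map⁻)
open import Data.List.Properties using (length-++; length-applyUpTo; filter-++; map-upTo; map-cong)
open import Data.List.Relation.Unary.All as All using (All; []; _∷_)
import Data.List.Relation.Unary.All.Properties as All
open import Data.List.Relation.Unary.Any as Any using (here; there)
import Data.List.Relation.Unary.Any.Properties as Any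
open import Data.Nat using (ℕ; zero; suc; _+_; _*_; _≤_; _<_; _∸_; z≤n; s≤s; _≡ᵇ_; _≟_)
open import Data.Nat.DivMod using (_%_; m<n⇒m%n≡m; n%n≡0; m%n<n)
open import Data.Nat.Properties
open import Data.Nat.Tactic.RingSolver using (solve-∀)
open import Data.Product using (_×_; _,_; proj₁; proj₂; ∃-syntax)
open import Data.Rational as ℚ using (ℚ; 0ℚ; 1ℚ; _-_; ∣_∣; mkℚ; toℚᵘ) renaming (_<_ to _<ℚ_)
import Data.Rational.Properties as ℚ
open import Data.Rational.Unnormalised as ℚᵘ using (mkℚᵘ)
import Data.Rational.Unnormalised.Properties as ℚᵘ
open import Data.Sum using (_⊎_; inj₁; inj₂)
open import Data.Unit using (⊤; tt)
open import Data.Vec as Vec using (Vec; []; _∷_)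
open import Data.Vec.Relation.Unary.Any as VecAny using (here; there)
open import Function using (_∘_; const; id; case_of_; mk⇔; Equivalence)
open import Relation.Binary.Construct.Closure.Equivalence as Eq using (EqClosure)
open import Relation.Binary.Construct.Closure.ReflexiveTransitive using (_◅_; _◅◅_) renaming (ε to stop)
open import Relation.Binary.Construct.Closure.Symmetric using (SymClosure; fwd; bwd)
open import Relation.Binary.PropositionalEquality
open import Relation.Nullary using (does)
open import Relation.Nullary.Decidable using (dec-true; dec-false)

-- Sums over bit vectors

select : {A : Set} {k : ℕ} → List A → Vec Bool k → List A
select []       _            = []
select (x ∷ xs) []           = []
select (x ∷ xs) (true  ∷ bs) = x ∷ select xs bs
select (x ∷ xs) (false ∷ bs) = select xs bs

indicator : Bool → ℕ
indicator b = if b then 1 else 0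

sumBits : ∀ k → (Vec Bool k → ℕ) → ℕ
sumBits zero    F = F []
sumBits (suc k) F = sumBits k (F ∘ (true ∷_)) + sumBits k (F ∘ (false ∷_))

sumBits-cong : ∀ k {F G : Vec Bool k → ℕ} → (∀ b → F b ≡ G b) → sumBits k F ≡ sumBits k G
sumBits-cong zero    eq = eq []
sumBits-cong (suc k) eq =
  cong₂ _+_ (sumBits-cong k (eq ∘ (true ∷_))) (sumBits-cong k (eq ∘ (false ∷_)))

sumBits-zero : ∀ k {F : Vec Bool k → ℕ} → (∀ b → F b ≡ 0) → sumBits k F ≡ 0
sumBits-zero zero    eq = eq []
sumBits-zero (suc k) eq =
  cong₂ _+_ (sumBits-zero k (eq ∘ (true ∷_))) (sumBits-zero k (eq ∘ (false ∷_)))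

sumBits-++ : ∀ k {l} (F : Vec Bool (k + l) → ℕ) →
  sumBits (k + l) F ≡ sumBits k (λ u → sumBits l (λ w → F (u Vec.++ w)))
sumBits-++ zero    F = refl
sumBits-++ (suc k) F =
  cong₂ _+_ (sumBits-++ k (F ∘ (true ∷_))) (sumBits-++ k (F ∘ (false ∷_)))

sumBits-≥-all-true : ∀ k (F : Vec Bool k → ℕ) → F (Vec.replicate k true) ≤ sumBits k F
sumBits-≥-all-true zero    F = ≤-refl
sumBits-≥-all-true (suc k) F =
  ≤-trans (sumBits-≥-all-true k (F ∘ (true ∷_))) (m≤m+n _ _)

count-map : {A B : Set} (f : B → Bool) (g : A → B) (xs : List A) →
  length (filter (T? ∘ f) (map g xs)) ≡ length (filter (T? ∘ f ∘ g) xs)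
count-map f g []       = refl
count-map f g (x ∷ xs) with f (g x)
... | true  = cong suc (count-map f g xs)
... | false = count-map f g xs

count-sublists : ∀ {A : Set} {k} (f : List A → Bool) (xs : List A) → length xs ≡ k →
  length (filter (T? ∘ f) (sublists xs)) ≡ sumBits k (λ b → indicator (f (select xs b)))
count-sublists f [] refl with f []
... | true  = refl
... | false = refl
count-sublists f (x ∷ xs) refl = begin
  length (filter (T? ∘ f) (map (x ∷_) (sublists xs) ++ sublists xs))
    ≡⟨ cong length (filter-++ (T? ∘ f) (map (x ∷_) (sublists xs)) (sublists xs)) ⟩
  length (filter (T? ∘ f) (map (x ∷_) (sublists xs)) ++ filter (T? ∘ f) (sublists xs))
    ≡⟨ length-++ (filter (T? ∘ f) (map (x ∷_) (sublists xs))) ⟩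
  length (filter (T? ∘ f) (map (x ∷_) (sublists xs))) + length (filter (T? ∘ f) (sublists xs))
    ≡⟨ cong₂ _+_ (trans (count-map f (x ∷_) (sublists xs)) (count-sublists (f ∘ (x ∷_)) xs refl))
                 (count-sublists f xs refl) ⟩
  sumBits (suc (length xs)) (λ b → indicator (f (select (x ∷ xs) b))) ∎
  where open ≡-Reasoning

falses : ∀ {k} → Vec Bool k → ℕ
falses []          = 0
falses (true  ∷ b) = falses b
falses (false ∷ b) = suc (falses b)

-- Since `F` vanishes from 2 on, only the vector without `false` and the k vectors with exactly one
-- `false` contribute. This produces the factor n for the choice of the missing edge.
sumBits-falses : ∀ k (F : ℕ → ℕ) → (∀ j → F (2 + j) ≡ 0) →
  sumBits k (F ∘ falses) ≡ F 0 + k * F 1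
sumBits-falses zero    F F₂ = sym (+-identityʳ (F 0))
sumBits-falses (suc k) F F₂ = begin
  sumBits k (F ∘ falses) + sumBits k (F ∘ suc ∘ falses)
    ≡⟨ cong₂ _+_ (sumBits-falses k F F₂) (sumBits-falses k (F ∘ suc) (F₂ ∘ suc)) ⟩
  (F 0 + k * F 1) + (F 1 + k * F 2)
    ≡⟨ cong (λ z → (F 0 + k * F 1) + (F 1 + k * z)) (F₂ 0) ⟩
  (F 0 + k * F 1) + (F 1 + k * 0)
    ≡⟨ rearrange (F 0) (F 1) k ⟩
  F 0 + suc k * F 1 ∎
  where
  open ≡-Reasoning
  rearrange : ∀ a b k → (a + k * b) + (b + k * 0) ≡ a + suc k * b
  rearrange = solve-∀

-- Growth of the generating polynomial

-- Generating polynomial, evaluated at n: an entry 0 (complete rim path) has weight 1,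
-- an entry 1 (one of its n edges missing) has weight n.
weightedSum : ℕ → ∀ m → (Vec ℕ m → ℕ) → ℕ
weightedSum n zero    G = G []
weightedSum n (suc m) G =
  weightedSum n m (G ∘ (0 ∷_)) + n * weightedSum n m (G ∘ (1 ∷_))

weightedSum-zero : ∀ n m {G : Vec ℕ m → ℕ} → (∀ c → G c ≡ 0) → weightedSum n m G ≡ 0
weightedSum-zero n zero    eq = eq []
weightedSum-zero n (suc m) eq =
  cong₂ _+_ (weightedSum-zero n m (eq ∘ (0 ∷_)))
            (trans (cong (n *_) (weightedSum-zero n m (eq ∘ (1 ∷_)))) (*-zeroʳ n))

weightedSum-≤-suc : ∀ n m G → weightedSum n m G ≤ weightedSum (suc n) m G
weightedSum-≤-suc n zero    G = ≤-refl
weightedSum-≤-suc n (suc m) G =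
  +-mono-≤ (weightedSum-≤-suc n m _) (*-mono-≤ (n≤1+n n) (weightedSum-≤-suc n m _))

weightedSum-≥-all-one : ∀ n m G → 1 ≤ n → G (Vec.replicate m 1) ≤ weightedSum n m G
weightedSum-≥-all-one n zero    G 1≤n = ≤-refl
weightedSum-≥-all-one n (suc m) G 1≤n = begin
  G (1 ∷ Vec.replicate m 1)          ≤⟨ weightedSum-≥-all-one n m (G ∘ (1 ∷_)) 1≤n ⟩
  w                                  ≡⟨ *-identityˡ w ⟨
  1 * w                              ≤⟨ *-monoˡ-≤ w 1≤n ⟩
  n * w                              ≤⟨ m≤n+m (n * w) _ ⟩
  weightedSum n (suc m) G ∎
  where
  open ≤-Reasoning
  w = weightedSum n m (G ∘ (1 ∷_))

-- This is 2^m - 1. The recursion g ↦ 1 + 2g is chosen so that (p + 1)(p + g) ≤ (p + 1 + 2g)p, which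
-- for p ≥ 1 comes down to g ≤ pg.
growth : ℕ → ℕ
growth zero    = 0
growth (suc m) = 1 + 2 * growth m

-- For p ≥ 1 this is (p + 1)ᵏ ≤ (1 + growth m / p) pᵏ, summed over the monomials, k ≤ m.
weightedSum-growth : ∀ p m G → 1 ≤ p →
  p * weightedSum (suc p) m G ≤ (p + growth m) * weightedSum p m G
weightedSum-growth p zero    G 1≤p = *-monoˡ-≤ (G []) (m≤m+n p 0)
weightedSum-growth p (suc m) G 1≤p = begin
  p * (A′ + suc p * B′)
    ≡⟨ distribute p A′ B′ ⟩
  p * A′ + suc p * (p * B′)
    ≤⟨ +-mono-≤ (weightedSum-growth p m _ 1≤p)
                (*-monoʳ-≤ (suc p) (weightedSum-growth p m _ 1≤p)) ⟩
  (p + g) * A + suc p * ((p + g) * B)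
    ≤⟨ +-mono-≤ (*-monoˡ-≤ A (+-monoʳ-≤ p g≤g′)) bound ⟩
  (p + growth (suc m)) * A + (p + growth (suc m)) * (p * B)
    ≡⟨ *-distribˡ-+ (p + growth (suc m)) A (p * B) ⟨
  (p + growth (suc m)) * (A + p * B) ∎
  where
  open ≤-Reasoning
  g = growth m
  A = weightedSum p m (G ∘ (0 ∷_))
  B = weightedSum p m (G ∘ (1 ∷_))
  A′ = weightedSum (suc p) m (G ∘ (0 ∷_))
  B′ = weightedSum (suc p) m (G ∘ (1 ∷_))
  g≤g′ : g ≤ growth (suc m)
  g≤g′ = ≤-trans (m≤m+n g (g + 0)) (n≤1+n _)
  distribute : ∀ p a b → p * (a + suc p * b) ≡ p * a + suc p * (p * b)
  distribute = solve-∀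
  left : ∀ p g b → suc p * ((p + g) * b) ≡ (p * p + p * g + p) * b + g * b
  left = solve-∀
  right : ∀ p g b → (p * p + p * g + p) * b + p * (g * b) ≡ (p + (1 + 2 * g)) * (p * b)
  right = solve-∀
  bound : suc p * ((p + g) * B) ≤ (p + growth (suc m)) * (p * B)
  bound = begin
    suc p * ((p + g) * B)                     ≡⟨ left p g B ⟩
    (p * p + p * g + p) * B + g * B           ≡⟨ cong ((p * p + p * g + p) * B +_) (*-identityˡ (g * B)) ⟨
    (p * p + p * g + p) * B + 1 * (g * B)     ≤⟨ +-monoʳ-≤ _ (*-monoˡ-≤ (g * B) 1≤p) ⟩
    (p * p + p * g + p) * B + p * (g * B)     ≡⟨ right p g B ⟩
    (p + growth (suc m)) * (p * B) ∎

-- Bits grouped by rim path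

sumBlocks : ∀ n m → (Vec (Vec Bool n) m → ℕ) → ℕ
sumBlocks n zero    F = F []
sumBlocks n (suc m) F = sumBits n (λ u → sumBlocks n m (F ∘ (u ∷_)))

sumBlocks-cong : ∀ n m {F G : Vec (Vec Bool n) m → ℕ} → (∀ us → F us ≡ G us) →
  sumBlocks n m F ≡ sumBlocks n m G
sumBlocks-cong n zero    eq = eq []
sumBlocks-cong n (suc m) eq = sumBits-cong n (λ u → sumBlocks-cong n m (eq ∘ (u ∷_)))

sumBits-concat : ∀ n m (F : Vec Bool (m * n) → ℕ) →
  sumBits (m * n) F ≡ sumBlocks n m (F ∘ Vec.concat)
sumBits-concat n zero    F = refl
sumBits-concat n (suc m) F =
  trans (sumBits-++ n F) (sumBits-cong n (λ u → sumBits-concat n m (F ∘ (u Vec.++_))))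

-- `sumBits-falses` applied to one block after another: each contributes its value at 0 plus n times
-- its value at 1, which is the recursion of `weightedSum`.
sumBlocks-falses : ∀ n m (G : Vec ℕ m → ℕ) →
  (∀ c → VecAny.Any (2 ≤_) c → G c ≡ 0) →
  sumBlocks n m (G ∘ Vec.map falses) ≡ weightedSum n m G
sumBlocks-falses n zero    G G₂ = refl
sumBlocks-falses n (suc m) G G₂ = trans
  (sumBits-cong n (λ u → sumBlocks-falses n m (G ∘ (falses u ∷_)) (λ c → G₂ _ ∘ there)))
  (sumBits-falses n (λ k → weightedSum n m (G ∘ (k ∷_)))
    (λ j → weightedSum-zero n m (λ c → G₂ _ (here (s≤s (s≤s z≤n))))))

-- Connectivity as existence of walks

T-ext : ∀ {a b} → (T a → T b) → (T b → T a) → a ≡ b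
T-ext f g = ⇔→≡ {z = true}
  (mk⇔ (to T-≡ ∘ f ∘ from T-≡) (to T-≡ ∘ g ∘ from T-≡))
  where open Equivalence

Adjacent : List Edge → ℕ → ℕ → Set
Adjacent es = SymClosure (λ u v → (u , v) ∈ es)

Walk : List Edge → ℕ → ℕ → Set
Walk es = EqClosure (λ u v → (u , v) ∈ es)

walk-sym : ∀ {es u v} → Walk es u v → Walk es v u
walk-sym = Eq.symmetric _

elem⇒∈ : ∀ {x} xs → T (elem x xs) → x ∈ xs
elem⇒∈ {x} xs = Any.map (≡ᵇ⇒≡ x _) ∘ Any.any⁻ (x ≡ᵇ_) xs

∈⇒elem : ∀ {x} {xs} → x ∈ xs → T (elem x xs)
∈⇒elem {x} = Any.any⁺ (x ≡ᵇ_) ∘ Any.map (≡⇒≡ᵇ x _)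

∈-if⁺ : ∀ {b} {x : ℕ} → T b → x ∈ (if b then x ∷ [] else [])
∈-if⁺ {true} _ = here refl

∈-if⁻ : ∀ {b} {x y : ℕ} → y ∈ (if b then x ∷ [] else []) → T b × y ≡ x
∈-if⁻ {true} (here y≡x) = tt , y≡x

-- The fold inside `step`, given a name: `step es R` unfolds to `R ++ frontier es R`.
frontier : List Edge → List ℕ → List ℕ
frontier es R = foldr (λ e acc → (if elem (proj₁ e) R then proj₂ e ∷ [] else [])
                                 ++ (if elem (proj₂ e) R then proj₁ e ∷ [] else [])
                                 ++ acc) [] es

frontier-⁺ : ∀ es {R u v} → u ∈ R → Adjacent es u v → v ∈ frontier es R
frontier-⁺ (_ ∷ es) u∈R (fwd (here refl)) = ∈-++⁺ˡ (∈-if⁺ (∈⇒elem u∈R))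
frontier-⁺ (e ∷ es) {R} u∈R (bwd (here refl)) =
  ∈-++⁺ʳ (if elem (proj₁ e) R then proj₂ e ∷ [] else []) (∈-++⁺ˡ (∈-if⁺ (∈⇒elem u∈R)))
frontier-⁺ (e ∷ es) {R} u∈R (fwd (there a)) =
  ∈-++⁺ʳ (if elem (proj₁ e) R then proj₂ e ∷ [] else [])
    (∈-++⁺ʳ (if elem (proj₂ e) R then proj₁ e ∷ [] else []) (frontier-⁺ es u∈R (fwd a)))
frontier-⁺ (e ∷ es) {R} u∈R (bwd (there a)) =
  ∈-++⁺ʳ (if elem (proj₁ e) R then proj₂ e ∷ [] else [])
    (∈-++⁺ʳ (if elem (proj₂ e) R then proj₁ e ∷ [] else []) (frontier-⁺ es u∈R (bwd a)))

adjacent-there : ∀ {e es u v} → Adjacent es u v → Adjacent (e ∷ es) u v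
adjacent-there (fwd a) = fwd (there a)
adjacent-there (bwd a) = bwd (there a)

frontier-⁻ : ∀ es {R v} → v ∈ frontier es R → ∃[ u ] u ∈ R × Adjacent es u v
frontier-⁻ (e ∷ es) {R} v∈ with ∈-++⁻ (if elem (proj₁ e) R then proj₂ e ∷ [] else []) v∈
... | inj₁ v∈₁ with ∈-if⁻ v∈₁
...   | t , refl = proj₁ e , elem⇒∈ R t , fwd (here refl)
frontier-⁻ (e ∷ es) {R} v∈ | inj₂ v∈₂
  with ∈-++⁻ (if elem (proj₂ e) R then proj₁ e ∷ [] else []) v∈₂
... | inj₁ v∈₃ with ∈-if⁻ v∈₃
...   | t , refl = proj₂ e , elem⇒∈ R t , bwd (here refl)
frontier-⁻ (e ∷ es) {R} v∈ | inj₂ v∈₂ | inj₂ v∈₄ with frontier-⁻ es v∈₄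
... | u , u∈R , a = u , u∈R , adjacent-there a

step-increasing : ∀ es {R x} → x ∈ R → x ∈ step es R
step-increasing es = ∈-++⁺ˡ

iter-increasing : ∀ k es {R x} → x ∈ R → x ∈ iter k (step es) R
iter-increasing zero    es x∈R = x∈R
iter-increasing (suc k) es x∈R = iter-increasing k es (step-increasing es x∈R)

iter-sound : ∀ k es R {v} → v ∈ iter k (step es) R → ∃[ u ] u ∈ R × Walk es u v
iter-sound zero    es R v∈ = _ , v∈ , stop
iter-sound (suc k) es R v∈ with iter-sound k es (step es R) v∈
... | w , w∈ , ws with ∈-++⁻ R w∈
...   | inj₁ w∈R = w , w∈R , ws
...   | inj₂ w∈F with frontier-⁻ es w∈F
...     | u , u∈R , a = u , u∈R , a ◅ ws

countBelow : ℕ → (ℕ → Bool) → ℕ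
countBelow zero    p = 0
countBelow (suc V) p = indicator (p V) + countBelow V p

-- Provides the progress measure for `iter-complete`: unless the count grows strictly, no vertex
-- below V has been added.
countBelow-⊆ : ∀ V {p q : ℕ → Bool} → (∀ x → T (p x) → T (q x)) →
  countBelow V p < countBelow V q ⊎
  (countBelow V p ≤ countBelow V q × (∀ x → x < V → T (q x) → T (p x)))
countBelow-⊆ zero p⊆q = inj₂ (z≤n , λ _ ())
countBelow-⊆ (suc V) {p} {q} p⊆q with p V in pV | q V in qV | countBelow-⊆ V p⊆q
... | true  | false | _       = ⊥-elim (subst T qV (p⊆q V (subst T (sym pV) tt)))
... | true  | true  | inj₁ lt = inj₁ (s≤s lt)
... | false | true  | inj₁ lt = inj₁ (m≤n⇒m≤1+n lt)
... | false | false | inj₁ lt = inj₁ lt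
... | false | true  | inj₂ (le , _) = inj₁ (s≤s le)
... | true  | true  | inj₂ (le , q⊆p) = inj₂ (s≤s le , below)
  where
  below : ∀ x → x < suc V → T (q x) → T (p x)
  below x x<1+V qx with m≤n⇒m<n∨m≡n (≤-pred x<1+V)
  ... | inj₁ x<V  = q⊆p x x<V qx
  ... | inj₂ refl = subst T (sym pV) tt
... | false | false | inj₂ (le , q⊆p) = inj₂ (le , below)
  where
  below : ∀ x → x < suc V → T (q x) → T (p x)
  below x x<1+V qx with m≤n⇒m<n∨m≡n (≤-pred x<1+V)
  ... | inj₁ x<V  = q⊆p x x<V qx
  ... | inj₂ refl = ⊥-elim (subst T qV qx)

countBelow-true : ∀ V → countBelow V (λ _ → true) ≡ V
countBelow-true zero    = refl
countBelow-true (suc V) = cong suc (countBelow-true V)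

EdgesBelow : ℕ → List Edge → Set
EdgesBelow V = All (λ e → proj₁ e < V × proj₂ e < V)

adjacent-< : ∀ {V es u v} → EdgesBelow V es → Adjacent es u v → v < V
adjacent-< below (fwd a) = proj₂ (All.lookup below a)
adjacent-< below (bwd a) = proj₁ (All.lookup below a)

walk-< : ∀ {V es u v} → EdgesBelow V es → u < V → Walk es u v → v < V
walk-< below u<V stop     = u<V
walk-< below u<V (a ◅ ws) = walk-< below (adjacent-< below a) ws

walk-closed : ∀ {V es R} → EdgesBelow V es →
  (∀ x → x < V → x ∈ step es R → x ∈ R) →
  ∀ {u v} → u ∈ R → Walk es u v → v ∈ R
walk-closed below closed u∈R stop = u∈R
walk-closed {es = es} {R} below closed u∈R (a ◅ ws) =
  walk-closed below closed
    (closed _ (adjacent-< below a) (∈-++⁺ʳ R (frontier-⁺ es u∈R a))) ws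

-- Each application of step either reaches a new vertex or shows that the set is closed;
-- k bounds the number of vertices not reached yet.
iter-complete : ∀ {V es} → EdgesBelow V es → ∀ k R → V ≤ k + countBelow V (λ x → elem x R) →
  ∀ {u v} → u < V → u ∈ R → Walk es u v → v ∈ iter k (step es) R
iter-complete {V} below zero R V≤ {u} {v} u<V u∈R ws
  -- With no steps left, R already counts V vertices. Comparison with the constantly true predicate,
  -- whose count is V, shows that R contains every vertex below V.
  with countBelow-⊆ V {λ x → elem x R} {λ _ → true} (λ _ _ → tt)
... | inj₁ lt = ⊥-elim (<⇒≱ lt (≤-trans (≤-reflexive (countBelow-true V)) V≤))
... | inj₂ (_ , full) = elem⇒∈ R (full v (walk-< below u<V ws) tt)
iter-complete {V} {es} below (suc k) R V≤ u<V u∈R ws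
  with countBelow-⊆ V {λ x → elem x R} {λ x → elem x (step es R)}
         (λ x t → ∈⇒elem {x} (step-increasing es (elem⇒∈ R t)))
... | inj₁ lt = iter-complete below k (step es R) (≤-trans V≤ more) u<V (step-increasing es u∈R) ws
  where
  more : suc k + countBelow V (λ x → elem x R) ≤ k + countBelow V (λ x → elem x (step es R))
  more = ≤-trans (≤-reflexive (sym (+-suc k _))) (+-monoʳ-≤ k lt)
... | inj₂ (_ , closed) = iter-increasing (suc k) es
  (walk-closed below (λ x x<V x∈ → elem⇒∈ R (closed x x<V (∈⇒elem x∈))) u∈R ws)

connectedIn⇒walk : ∀ V es {u v} → T (connectedIn V es u v) → Walk es u v
connectedIn⇒walk V es {u} t with iter-sound V es (u ∷ []) (elem⇒∈ (iter V (step es) (u ∷ [])) t)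
... | _ , here refl , ws = ws

walk⇒connectedIn : ∀ {V es u v} → EdgesBelow V es → u < V → Walk es u v →
  T (connectedIn V es u v)
walk⇒connectedIn {V} {es} {u} below u<V ws =
  ∈⇒elem {xs = iter V (step es) (u ∷ [])}
    (iter-complete below V (u ∷ []) (m≤m+n V _) u<V (here refl) ws)

isConnected⇒walk : ∀ V es → T (isConnected V es) → ∀ {v} → v < V → Walk es 0 v
isConnected⇒walk V es t v<V =
  connectedIn⇒walk V es (All.lookup (All.all⁺ (connectedIn V es 0) (upTo V) t) (∈-upTo⁺ v<V))

walk⇒isConnected : ∀ {V es} → EdgesBelow V es → (∀ {v} → v < V → Walk es 0 v) →
  T (isConnected V es)
walk⇒isConnected {V} {es} below ws = All.all⁻ (connectedIn V es 0)
  (All.tabulate {xs = upTo V} λ v∈ → let v<V = ∈-upTo⁻ v∈ in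
    walk⇒connectedIn below (≤-trans (s≤s z≤n) v<V) (ws v<V))

-- Spanning trees as minimal connected edge sets

picks-∈ : ∀ {es : List Edge} {p} → p ∈ picks es → proj₁ p ∈ es
picks-∈ {e ∷ es} (here refl) = here refl
picks-∈ {e ∷ es} (there p∈) with ∈-map⁻ _ p∈
... | _ , q∈ , refl = there (picks-∈ q∈)

picks-⊆ : ∀ {es : List Edge} {p} → p ∈ picks es → ∀ {e} → e ∈ proj₂ p → e ∈ es
picks-⊆ {_ ∷ es} (here refl) e∈ = there e∈
picks-⊆ {_ ∷ es} (there p∈) e∈ with ∈-map⁻ _ p∈
picks-⊆ {_ ∷ es} (there p∈) (here refl) | _ , q∈ , refl = here refl
picks-⊆ {_ ∷ es} (there p∈) (there e∈)  | _ , q∈ , refl = there (picks-⊆ q∈ e∈)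

picks-split : ∀ {es : List Edge} {p} → p ∈ picks es → ∀ {e} → e ∈ es → e ≡ proj₁ p ⊎ e ∈ proj₂ p
picks-split {_ ∷ es} (here refl) (here refl) = inj₁ refl
picks-split {_ ∷ es} (here refl) (there e∈)  = inj₂ e∈
picks-split {_ ∷ es} (there p∈) e∈ with ∈-map⁻ _ p∈
picks-split {_ ∷ es} (there p∈) (here refl) | _ , q∈ , refl = inj₂ (here refl)
picks-split {_ ∷ es} (there p∈) (there e∈)  | _ , q∈ , refl with picks-split q∈ e∈
... | inj₁ eq  = inj₁ eq
... | inj₂ e∈′ = inj₂ (there e∈′)

-- If the ends of the deleted edge are still joined, every walk that used it can be rerouted.
-- Conversely, both ends are reachable from 0.
connectedIn-pick : ∀ {V es} → EdgesBelow V es → T (isConnected V es) →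
  ∀ {p} → p ∈ picks es →
  connectedIn V (proj₂ p) (proj₁ (proj₁ p)) (proj₂ (proj₁ p)) ≡ isConnected V (proj₂ p)
connectedIn-pick {V} {es} below conn {(u , v) , rest} p∈ = T-ext to from
  where
  below′ : EdgesBelow V rest
  below′ = All.tabulate (All.lookup below ∘ picks-⊆ p∈)
  bounds : u < V × v < V
  bounds = All.lookup below (picks-∈ p∈)
  to : T (connectedIn V rest u v) → T (isConnected V rest)
  to t = walk⇒isConnected below′ (λ v<V → (reroute Eq.⋆) (isConnected⇒walk V es conn v<V))
    where
    reroute : ∀ {x y} → (x , y) ∈ es → Walk rest x y
    reroute e∈ with picks-split p∈ e∈
    ... | inj₁ refl = connectedIn⇒walk V rest t
    ... | inj₂ e∈′  = Eq.return e∈′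
  from : T (isConnected V rest) → T (connectedIn V rest u v)
  from t = walk⇒connectedIn below′ (proj₁ bounds)
    (walk-sym (isConnected⇒walk V rest t (proj₁ bounds)) ◅◅ isConnected⇒walk V rest t (proj₂ bounds))

all-cong : {A : Set} {p q : A → Bool} (xs : List A) → (∀ {x} → x ∈ xs → p x ≡ q x) →
  all p xs ≡ all q xs
all-cong []       eq = refl
all-cong (x ∷ xs) eq = cong₂ _∧_ (eq (here refl)) (all-cong xs (eq ∘ there))

∧-congʳ-true : ∀ {a b c} → (T a → b ≡ c) → a ∧ b ≡ a ∧ c
∧-congʳ-true {true}  eq = eq tt
∧-congʳ-true {false} eq = refl

-- The first conjunct supplies the connectivity that `connectedIn-pick` needs. From here on
-- `isConnected` is the only graph predicate to be evaluated.
isSpanningTree-minimal : ∀ {V es} → EdgesBelow V es →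
  isSpanningTree V es ≡ isConnected V es ∧ all (not ∘ isConnected V ∘ proj₂) (picks es)
isSpanningTree-minimal {V} {es} below = ∧-congʳ-true λ conn →
  all-cong (picks es) (cong not ∘ connectedIn-pick below conn)

-- Scanning the rim

-- Deletion of a single chosen edge in terms of bits, corresponding to `all` over `picks`; see
-- `all-picks-select`.
allFlips : ∀ {k} → (Vec Bool k → Bool) → Vec Bool k → Bool
allFlips p []          = true
allFlips p (true  ∷ b) = p (false ∷ b) ∧ allFlips (p ∘ (true ∷_)) b
allFlips p (false ∷ b) = allFlips (p ∘ (false ∷_)) b

allFlips-cong : ∀ {k} {p q : Vec Bool k → Bool} → (∀ b → p b ≡ q b) →
  ∀ b → allFlips p b ≡ allFlips q b
allFlips-cong eq []          = refl
allFlips-cong eq (true  ∷ b) = cong₂ _∧_ (eq (false ∷ b)) (allFlips-cong (eq ∘ (true ∷_)) b)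
allFlips-cong eq (false ∷ b) = allFlips-cong (eq ∘ (false ∷_)) b

allFlips-++ : ∀ {k l} (p : Vec Bool (k + l) → Bool) (u : Vec Bool k) (w : Vec Bool l) →
  allFlips p (u Vec.++ w) ≡
  allFlips (λ u′ → p (u′ Vec.++ w)) u ∧ allFlips (λ w′ → p (u Vec.++ w′)) w
allFlips-++ p []          w = refl
allFlips-++ p (true  ∷ u) w =
  trans (cong (p (false ∷ (u Vec.++ w)) ∧_) (allFlips-++ (p ∘ (true ∷_)) u w))
        (sym (∧-assoc (p (false ∷ (u Vec.++ w))) _ _))
allFlips-++ p (false ∷ u) w = allFlips-++ (p ∘ (false ∷_)) u w

all-map : {A B : Set} (p : B → Bool) (f : A → B) (xs : List A) →
  all p (List.map f xs) ≡ all (p ∘ f) xs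
all-map p f []       = refl
all-map p f (x ∷ xs) = cong (p (f x) ∧_) (all-map p f xs)

all-picks-select : ∀ {A : Set} {k} (q : List A → Bool) (xs : List A) (b : Vec Bool k) →
  List.length xs ≡ k → all (q ∘ proj₂) (picks (select xs b)) ≡ allFlips (q ∘ select xs) b
all-picks-select q []       []          refl = refl
all-picks-select q (x ∷ xs) (true  ∷ b) refl = cong (q (select xs b) ∧_)
  (trans (all-map (q ∘ proj₂) _ (picks (select xs b))) (all-picks-select (q ∘ (x ∷_)) xs b refl))
all-picks-select q (x ∷ xs) (false ∷ b) refl = all-picks-select q xs b refl

-- Every flip raises the number of `false` entries by exactly one, so all the tests evaluate `g` at
-- the same argument.
allFlips-falses-true : ∀ {k} (g : ℕ → Bool) (u : Vec Bool k) →
  g (suc (falses u)) ≡ true → allFlips (g ∘ falses) u ≡ true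
allFlips-falses-true g []          eq = refl
allFlips-falses-true g (true  ∷ u) eq = cong₂ _∧_ eq (allFlips-falses-true g u eq)
allFlips-falses-true g (false ∷ u) eq = allFlips-falses-true (g ∘ suc) u eq

-- All tests evaluate `g` at 1, and nonemptiness ensures that there is at least one test.
allFlips-no-falses : ∀ {k} (g : ℕ → Bool) (u : Vec Bool (suc k)) → falses u ≡ 0 →
  allFlips (g ∘ falses) u ≡ g 1
allFlips-no-falses g (true ∷ u) eq with g (suc (falses u)) in e
... | true  = trans (allFlips-falses-true g u e) (trans (sym e) (cong (g ∘ suc) eq))
... | false = trans (sym e) (cong (g ∘ suc) eq)

-- What `allFlips` becomes once each path is replaced by its number of missing edges. Positive
-- entries are skipped because raising them gives at least 2, where the predicate in question,
-- rejection by the scan, is true.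
allRaises : ∀ {m} → (Vec ℕ m → Bool) → Vec ℕ m → Bool
allRaises q []          = true
allRaises q (zero  ∷ c) = q (1 ∷ c) ∧ allRaises (q ∘ (0 ∷_)) c
allRaises q (suc k ∷ c) = allRaises (q ∘ (suc k ∷_)) c

allFlips-blocks : ∀ {n m} (p : Vec Bool (m * suc n) → Bool) (q : Vec ℕ m → Bool) →
  (∀ us → p (Vec.concat us) ≡ q (Vec.map falses us)) →
  (∀ c → VecAny.Any (2 ≤_) c → q c ≡ true) →
  ∀ us → allFlips p (Vec.concat us) ≡ allRaises q (Vec.map falses us)
allFlips-blocks p q pq q₂ []       = refl
allFlips-blocks {n} p q pq q₂ (u ∷ us) = trans (allFlips-++ p u (Vec.concat us))
  (trans (cong₂ _∧_ (allFlips-cong (λ u′ → pq (u′ ∷ us)) u)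
                    (allFlips-blocks (p ∘ (u Vec.++_)) (q ∘ (falses u ∷_))
                      (pq ∘ (u ∷_)) (λ c → q₂ _ ∘ there) us))
         first)
  where
  g : ℕ → Bool
  g k = q (k ∷ Vec.map falses us)
  first : allFlips (g ∘ falses) u ∧ allRaises (q ∘ (falses u ∷_)) (Vec.map falses us)
          ≡ allRaises q (falses u ∷ Vec.map falses us)
  first with falses u in e
  ... | zero  = cong (_∧ allRaises (q ∘ (0 ∷_)) (Vec.map falses us)) (allFlips-no-falses g u e)
  ... | suc k = cong (_∧ allRaises (q ∘ (suc k ∷_)) (Vec.map falses us))
    (allFlips-falses-true g u (trans (cong (g ∘ suc) e) (q₂ _ (here (s≤s (s≤s z≤n))))))

-- The rim is scanned from vertex 0.  before a: no rim edge was missing so far, and a tells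
-- whether a spoke was met.  after a c: a tells whether a spoke was met before the first
-- missing rim edge, c whether one was met after the last.  dead: two consecutive missing
-- edges enclose an arc without spoke.
data State : Set where
  before : Bool → State
  after  : Bool → Bool → State
  dead   : State

readSpoke : Bool → State → State
readSpoke false st          = st
readSpoke true  (before _)  = before true
readSpoke true  (after a _) = after a true
readSpoke true  dead        = dead

readMissing : State → State
readMissing (before a)      = after a false
readMissing (after a true)  = after a false
readMissing (after a false) = dead
readMissing dead            = dead

readPath : ℕ → State → State
readPath zero    st = st
readPath (suc k) st = readPath k (readMissing st)

-- The scan ends at vertex 0, so the last arc and the first one are the same.
accept : State → Bool
accept (before a)  = a
accept (after a c) = a ∨ c
accept dead        = false

scan : ∀ {m} → State → Vec ℕ m → Vec Bool m → Bool
scan st []      []      = accept st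
scan st (k ∷ c) (s ∷ t) = scan (readPath k (readSpoke s st)) c t

readPath-dead : ∀ k → readPath k dead ≡ dead
readPath-dead zero    = refl
readPath-dead (suc k) = readPath-dead k

scan-dead : ∀ {m} (c : Vec ℕ m) t → scan dead c t ≡ false
scan-dead []      []          = refl
scan-dead (k ∷ c) (true  ∷ t) rewrite readPath-dead k = scan-dead c t
scan-dead (k ∷ c) (false ∷ t) rewrite readPath-dead k = scan-dead c t

-- Spokes are read only at the start of a path, so two edges missing from the same path enclose an
-- arc without spoke.
readPath-2+ : ∀ k st → readPath (2 + k) st ≡ dead
readPath-2+ k (before a)      = readPath-dead k
readPath-2+ k (after a true)  = readPath-dead k
readPath-2+ k (after a false) = readPath-dead k
readPath-2+ k dead            = readPath-dead k

scan-2≤ : ∀ {m} st (c : Vec ℕ m) t → VecAny.Any (2 ≤_) c → scan st c t ≡ false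
scan-2≤ st (suc (suc k) ∷ c) (s ∷ t) (here _)
  rewrite readPath-2+ k (readSpoke s st) = scan-dead c t
scan-2≤ st (suc zero ∷ c) (s ∷ t) (here (s≤s ()))
scan-2≤ st (k ∷ c) (s ∷ t) (there 2≤) = scan-2≤ _ c t 2≤

-- Encodes the spanning trees of the wheel with m spokes: rim entry 0 for present, 1 for missing.
isWheelTree : ∀ {m} → Vec ℕ m → Vec Bool m → Bool
isWheelTree c t = scan (before false) c t ∧
  (allRaises (λ c′ → not (scan (before false) c′ t)) c ∧
   allFlips (λ t′ → not (scan (before false) c t′)) t)

isWheelTree-2≤ : ∀ {m} (c : Vec ℕ m) t → VecAny.Any (2 ≤_) c → isWheelTree c t ≡ false
isWheelTree-2≤ c t 2≤ rewrite scan-2≤ (before false) c t 2≤ = refl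

wheelTrees : ∀ {m} → Vec ℕ m → ℕ
wheelTrees {m} c = sumBits m (indicator ∘ isWheelTree c)

wheelTrees-2≤ : ∀ {m} (c : Vec ℕ m) → VecAny.Any (2 ≤_) c → wheelTrees c ≡ 0
wheelTrees-2≤ {m} c 2≤ = sumBits-zero m (λ t → cong indicator (isWheelTree-2≤ c t 2≤))

ones : ∀ m → Vec ℕ m
ones m = Vec.replicate m 1

trues : ∀ m → Vec Bool m
trues m = Vec.replicate m true

-- A spoke followed by a missing edge leads from `after a false` back to itself. Here `a` records
-- the first spoke: `true` for the full star, `false` when that spoke is deleted.
scan-star : ∀ m a → scan (after a false) (ones m) (trues m) ≡ a
scan-star zero    true  = refl
scan-star zero    false = refl
scan-star (suc m) a     = scan-star m a

-- A deleted later spoke leaves the arc between two consecutive missing edges without spoke, so the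
-- scan dies.
star-flips : ∀ m a → allFlips (λ t → not (scan (after a false) (ones m) t)) (trues m) ≡ true
star-flips zero    a = refl
star-flips (suc m) a = cong₂ _∧_ (cong not (scan-dead (ones m) (trues m))) (star-flips m a)

ones-raises : ∀ m (q : Vec ℕ m → Bool) → allRaises q (ones m) ≡ true
ones-raises zero    q = refl
ones-raises (suc m) q = ones-raises m (q ∘ (1 ∷_))

isWheelTree-star : ∀ m → isWheelTree (ones (suc m)) (trues (suc m)) ≡ true
isWheelTree-star m = cong₂ _∧_ (scan-star m true) (cong₂ _∧_
  (ones-raises (suc m) (λ c → not (scan (before false) c (trues (suc m)))))
  (cong₂ _∧_ (cong not (scan-star m false)) (star-flips m true)))

-- Conditions along rim and spokes

Marked : ∀ {k} → (ℕ → Set) → Vec Bool k → Set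
Marked R []       = ⊤
Marked R (b ∷ bs) = (T b → R 0) × Marked (R ∘ suc) bs

-- `Linked` serves the rim edges and `Marked` the spokes. The conditions are walks when acceptance
-- is shown to give connectivity, and conditions on colours in the converse.
Linked : ∀ {k} {A : Set} → (A → A → Set) → (ℕ → A) → Vec Bool k → Set
Linked R v []       = ⊤
Linked R v (b ∷ bs) = (T b → R (v 0) (v 1)) × Linked R (v ∘ suc) bs

Linked-++⁺ : ∀ {k l} {A : Set} {R : A → A → Set} {v} (u : Vec Bool k) {w : Vec Bool l} →
  Linked R v u → Linked R (v ∘ (k +_)) w → Linked R v (u Vec.++ w)
Linked-++⁺ []      _        lw = lw
Linked-++⁺ (_ ∷ u) (l , lu) lw = l , Linked-++⁺ u lu lw

Linked-++⁻ : ∀ {k l} {A : Set} {R : A → A → Set} {v} (u : Vec Bool k) {w : Vec Bool l} →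
  Linked R v (u Vec.++ w) → Linked R v u × Linked R (v ∘ (k +_)) w
Linked-++⁻ []      lw       = tt , lw
Linked-++⁻ (_ ∷ u) (l , lw) with Linked-++⁻ u lw
... | lu , lw′ = (l , lu) , lw′

module _ {A : Set} {Q : A → Set} where

  select-All : ∀ {k} {xs} (b : Vec Bool k) → All Q xs → All Q (select xs b)
  select-All b           []         = []
  select-All []          (_  ∷ _)   = []
  select-All (true  ∷ b) (qx ∷ qxs) = qx ∷ select-All b qxs
  select-All (false ∷ b) (_  ∷ qxs) = select-All b qxs

  Marked⇒All : ∀ {k R g} (b : Vec Bool k) → (∀ p → p < k → R p → Q (g p)) →
    Marked R b → All Q (select (applyUpTo g k) b)
  Marked⇒All []          f _        = []
  Marked⇒All (true  ∷ b) f (r , rs) = f 0 (s≤s z≤n) (r tt) ∷ Marked⇒All b (λ p → f (suc p) ∘ s≤s) rs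
  Marked⇒All (false ∷ b) f (_ , rs) = Marked⇒All b (λ p → f (suc p) ∘ s≤s) rs

  All⇒Marked : ∀ {k R g} (b : Vec Bool k) → (∀ p → p < k → Q (g p) → R p) →
    All Q (select (applyUpTo g k) b) → Marked R b
  All⇒Marked []          f _        = tt
  All⇒Marked (true  ∷ b) f (q ∷ qs) =
    (λ _ → f 0 (s≤s z≤n) q) , All⇒Marked b (λ p → f (suc p) ∘ s≤s) qs
  All⇒Marked (false ∷ b) f qs       = (λ ()) , All⇒Marked b (λ p → f (suc p) ∘ s≤s) qs

  Linked⇒All : ∀ {k B} {R : B → B → Set} {v g} (b : Vec Bool k) →
    (∀ p → p < k → R (v p) (v (suc p)) → Q (g p)) →
    Linked R v b → All Q (select (applyUpTo g k) b)
  Linked⇒All []          f _        = []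
  Linked⇒All (true  ∷ b) f (r , rs) = f 0 (s≤s z≤n) (r tt) ∷ Linked⇒All b (λ p → f (suc p) ∘ s≤s) rs
  Linked⇒All (false ∷ b) f (_ , rs) = Linked⇒All b (λ p → f (suc p) ∘ s≤s) rs

  All⇒Linked : ∀ {k B} {R : B → B → Set} {v g} (b : Vec Bool k) →
    (∀ p → p < k → Q (g p) → R (v p) (v (suc p))) →
    All Q (select (applyUpTo g k) b) → Linked R v b
  All⇒Linked []          f _        = tt
  All⇒Linked (true  ∷ b) f (q ∷ qs) =
    (λ _ → f 0 (s≤s z≤n) q) , All⇒Linked b (λ p → f (suc p) ∘ s≤s) qs
  All⇒Linked (false ∷ b) f qs       = (λ ()) , All⇒Linked b (λ p → f (suc p) ∘ s≤s) qs

select-++ : ∀ {A : Set} {k l} (xs ys : List A) (u : Vec Bool k) (w : Vec Bool l) →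
  length xs ≡ k → select (xs ++ ys) (u Vec.++ w) ≡ select xs u ++ select ys w
select-++ []       ys []          w refl = refl
select-++ (x ∷ xs) ys (true  ∷ u) w refl = cong (x ∷_) (select-++ xs ys u w refl)
select-++ (x ∷ xs) ys (false ∷ u) w refl = select-++ xs ys u w refl

-- Accepted edge sets are connected

-- o is the initial (and final) vertex of the scan, c the centre, x the vertex being scanned.
Invariant : List Edge → (o c : ℕ) → State → ℕ → Set
Invariant es o c (before a)  x = Walk es x o × (T a → Walk es o c)
Invariant es o c (after a b) x = (T a → Walk es o c) × (T b → Walk es x c)
Invariant es o c dead        x = ⊤

Reached : List Edge → (o c : ℕ) → State → Set
Reached es o c st = st ≢ dead × Walk es o c

module _ {es : List Edge} {o c : ℕ} where

  invariant-walk : ∀ st {x y} → Walk es x y → Invariant es o c st x → Invariant es o c st y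
  invariant-walk (before _)  x~y (x~o , a) = walk-sym x~y ◅◅ x~o , a
  invariant-walk (after _ _) x~y (a , b)   = a , λ t → walk-sym x~y ◅◅ b t
  invariant-walk dead        x~y _         = tt

  invariant-missing : ∀ st {x y} → Invariant es o c st x → Invariant es o c (readMissing st) y
  invariant-missing (before _)      (_ , a) = a , λ ()
  invariant-missing (after _ true)  (a , _) = a , λ ()
  invariant-missing (after _ false) _       = tt
  invariant-missing dead            _       = tt

  -- Just before a gap, x is tied to the centre through o if this is the first gap, and otherwise by
  -- a spoke of its own arc; without such a spoke the scan would die.
  reached-missing : ∀ st {x} → Invariant es o c st x → Reached es o c (readMissing st) →
    Reached es o c st × Walk es x c
  reached-missing (before _)      (x~o , _) (_ , o~c) = ((λ ()) , o~c) , x~o ◅◅ o~c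
  reached-missing (after _ true)  (_ , b)   (_ , o~c) = ((λ ()) , o~c) , b tt
  reached-missing (after _ false) _         (d , _)   = ⊥-elim (d refl)
  reached-missing dead            _         (d , _)   = ⊥-elim (d refl)

  invariant-spoke : ∀ s st {x} → (T s → Walk es x c) → Invariant es o c st x →
    Invariant es o c (readSpoke s st) x
  invariant-spoke false st          _   inv       = inv
  invariant-spoke true  (before _)  x~c (x~o , _) = x~o , λ _ → walk-sym x~o ◅◅ x~c tt
  invariant-spoke true  (after _ _) x~c (a , _)   = a , x~c
  invariant-spoke true  dead        _   _         = tt

  reached-spoke : ∀ s st → Reached es o c (readSpoke s st) → Reached es o c st
  reached-spoke false st          r       = r
  reached-spoke true  (before _)  (_ , w) = (λ ()) , w
  reached-spoke true  (after _ _) (_ , w) = (λ ()) , w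
  reached-spoke true  dead        (d , _) = ⊥-elim (d refl)

  -- A vertex may be tied to the centre only by a spoke met later. So the invariant travels
  -- forwards, the continuation treats the rest of the rim, and the walks to the centre are
  -- assembled on the way back.
  path-reaches : ∀ {k l} (u : Vec Bool k) v st → Linked (Walk es) v u →
    Invariant es o c st (v 0) →
    (Invariant es o c (readPath (falses u) st) (v (k + 0)) →
      Reached es o c (readPath (falses u) st) × (∀ p → p ≤ l → Walk es (v (k + p)) c)) →
    Reached es o c st × (∀ p → p ≤ k + l → Walk es (v p) c)
  path-reaches [] v st _ inv rest = rest inv
  path-reaches (true ∷ u) v st (l , ls) inv rest
    with path-reaches u (v ∘ suc) st ls (invariant-walk st (l tt) inv) rest
  ... | r , w = r , λ { zero _ → l tt ◅◅ w 0 z≤n ; (suc p) (s≤s p≤) → w p p≤ }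
  path-reaches (false ∷ u) v st (_ , ls) inv rest
    with path-reaches u (v ∘ suc) (readMissing st) ls (invariant-missing st inv) rest
  ... | r , w with reached-missing st inv r
  ...   | r′ , w₀ = r′ , λ { zero _ → w₀ ; (suc p) (s≤s p≤) → w p p≤ }

  accept-reaches : ∀ st → T (accept st) → Invariant es o c st o → Reached es o c st
  accept-reaches (before true)      _ (_ , a) = (λ ()) , a tt
  accept-reaches (after true _)     _ (a , _) = (λ ()) , a tt
  accept-reaches (after false true) _ (_ , b) = (λ ()) , b tt

  scan-reaches : ∀ {n m} (us : Vec (Vec Bool n) m) (t : Vec Bool m) v st →
    Linked (Walk es) v (Vec.concat us) → Marked (λ k → Walk es (v (k * n)) c) t →
    Invariant es o c st (v 0) → v (m * n) ≡ o → T (scan st (Vec.map falses us) t) →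
    Reached es o c st × (∀ p → p ≤ m * n → Walk es (v p) c)
  scan-reaches [] [] v st _ _ inv refl acc with accept-reaches st acc inv
  ... | r = r , λ { zero z≤n → proj₂ r }
  scan-reaches {n} (u ∷ us) (s ∷ t) v st ls (sp , sps) inv v≡o acc with Linked-++⁻ u ls
  ... | lu , lus with path-reaches u v (readSpoke s st) lu (invariant-spoke s st sp inv)
                        (λ inv′ → scan-reaches us t (v ∘ (n +_)) _ lus sps inv′ v≡o acc)
  ...   | r , w = reached-spoke s st r , w

-- Rejected edge sets are disconnected

-- Colours the vertices of a proper union of components, with true on the side of the centre;
-- x is the colour of the initial (and final) vertex of the scan and y that of the vertex
-- being scanned.
Colours : State → (x y : Bool) → Set
Colours (before a)  x y = x ≡ y × (T a → T x)
Colours (after a b) x y = (T a → T x) × (T b → T y)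
Colours dead        x y = T x × T y

-- In state dead the scan has already left a false vertex behind.
Coloured : ℕ → State → (ℕ → Bool) → Set
Coloured l st χ = st ≡ dead ⊎ ∃[ p ] p ≤ l × χ p ≡ false

prepend : Bool → (ℕ → Bool) → ℕ → Bool
prepend y χ zero    = y
prepend y χ (suc p) = χ p

Coloured-prepend : ∀ {l st y χ} → Coloured l st χ → Coloured (suc l) st (prepend y χ)
Coloured-prepend (inj₁ d)             = inj₁ d
Coloured-prepend (inj₂ (p , p≤l , f)) = inj₂ (suc p , s≤s p≤l , f)

-- The colouring is built from the end of the scan backwards. A missing edge does not constrain the
-- colour of its first end, so the state dictates it. In `after a false` the arc closed by the gap
-- has no spoke: it becomes `false` and yields the required false vertex.
missing-colours : ∀ {l} st {x χ} → Colours (readMissing st) x (χ 0) → Coloured l (readMissing st) χ →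
  ∃[ y ] Colours st x y × Coloured (suc l) st (prepend y χ)
missing-colours (before a) {x} (a⇒x , _) col = x , (refl , a⇒x) , still col
  where
  still : ∀ {l χ y} → Coloured l (after a false) χ → Coloured (suc l) (before a) (prepend y χ)
  still (inj₂ c) = Coloured-prepend (inj₂ c)
missing-colours (after a true) (a⇒x , _) col = true , (a⇒x , const tt) , still col
  where
  still : ∀ {l χ y} → Coloured l (after a false) χ → Coloured (suc l) (after a true) (prepend y χ)
  still (inj₂ c) = Coloured-prepend (inj₂ c)
missing-colours (after a false) (x , _) col = false , (const x , λ ()) , inj₂ (0 , z≤n , refl)
missing-colours dead (x , _) col = true , (x , tt) , inj₁ refl

-- `K` collects what is already secured for the rest of the rim. It concerns positions from k on
-- only, so prepending colours preserves it.
path-colours : ∀ {k l x} (u : Vec Bool k) st (K : (ℕ → Bool) → Set) →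
  ∃[ χ ] K χ × Colours (readPath (falses u) st) x (χ 0) × Coloured l (readPath (falses u) st) χ →
  ∃[ χ ] K (χ ∘ (k +_)) × Linked _≡_ χ u × Colours st x (χ 0) × Coloured (k + l) st χ
path-colours []          st K (χ , Kχ , cs , col) = χ , Kχ , tt , cs , col
path-colours (true ∷ u)  st K h with path-colours u st K h
... | χ , Kχ , lu , cs , col =
  prepend (χ 0) χ , Kχ , (const refl , lu) , cs , Coloured-prepend {χ = χ} col
path-colours (false ∷ u) st K h with path-colours u (readMissing st) K h
... | χ , Kχ , lu , cs , col with missing-colours st {χ = χ} cs col
...   | y , cs′ , col′ = prepend y χ , Kχ , ((λ ()) , lu) , cs′ , col′

spoke-colours : ∀ s st {x y} → Colours (readSpoke s st) x y → (T s → T y) × Colours st x y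
spoke-colours false st          cs           = (λ ()) , cs
spoke-colours true  (before _)  (refl , t)   = t , refl , λ _ → t tt
spoke-colours true  (after _ _) (a⇒x , t)    = t , a⇒x , λ _ → t tt
spoke-colours true  dead        (x , y)      = const y , x , y

Coloured-spoke : ∀ {l χ} s st → Coloured l (readSpoke s st) χ → Coloured l st χ
Coloured-spoke false st          col      = col
Coloured-spoke true  (before _)  (inj₂ c) = inj₂ c
Coloured-spoke true  (after _ _) (inj₂ c) = inj₂ c
Coloured-spoke true  dead        col      = inj₁ refl

scan-colours : ∀ {n m} (us : Vec (Vec Bool n) m) (t : Vec Bool m) st →
  scan st (Vec.map falses us) t ≡ false →
  ∃[ x ] ∃[ χ ] (Linked _≡_ χ (Vec.concat us) × Marked (λ k → T (χ (k * n))) t × χ (m * n) ≡ x)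
    × Colours st x (χ 0) × Coloured (m * n) st χ
-- The three rejecting final states. In the first two, the arc through the initial vertex met no
-- spoke and is coloured `false`; in `dead`, a false vertex lies behind and the last vertex is
-- `true`.
scan-colours [] [] (before false) _ =
  false , const false , (tt , tt , refl) , (refl , λ ()) , inj₂ (0 , z≤n , refl)
scan-colours [] [] (after false false) _ =
  false , const false , (tt , tt , refl) , ((λ ()) , λ ()) , inj₂ (0 , z≤n , refl)
scan-colours [] [] dead _ = true , const true , (tt , tt , refl) , (tt , tt) , inj₁ refl
scan-colours {n} {suc m} (u ∷ us) (s ∷ t) st rej
  with scan-colours us t (readPath (falses u) (readSpoke s st)) rej
... | x , h
  with path-colours u (readSpoke s st)
         (λ χ → Linked _≡_ χ (Vec.concat us) × Marked (λ k → T (χ (k * n))) t × χ (m * n) ≡ x) h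
...   | χ , (lus , mt , end) , lu , cs , col with spoke-colours s st cs
...     | sp , cs′ = x , χ , (Linked-++⁺ u lu lus , (sp , mt) , end) , cs′ , Coloured-spoke s st col

-- Jahangir graphs as subdivided wheels

-- Vertex p on the rim is stored as p % N, so that the scan, which closes up at p = N,
-- returns to vertex 0.
module Subdivided (n′ m′ : ℕ) where

  n m N : ℕ
  n = suc n′
  m = suc m′
  N = m * n

  rimEdge spokeEdge : ℕ → Edge
  rimEdge i   = i , suc i % N
  spokeEdge k = N , k * n

  allEdges : List Edge
  allEdges = applyUpTo rimEdge N ++ applyUpTo spokeEdge m

  -- `Vec.concat` of m blocks of n bits has length m * n, hence the commuted products. The modulus
  -- `suc (N ∸ 1)` computes to `N`, which is a successor.
  Jahangir≡ : Jahangir n m ≡ mkGraph (suc N) allEdges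
  Jahangir≡ = trans (cong graph (*-comm n m))
    (cong (mkGraph (suc N)) (cong₂ _++_ (map-upTo rimEdge N)
      (trans (map-cong (λ k → cong (N ,_) (*-comm n k)) (List.upTo m)) (map-upTo spokeEdge m))))
    where
    graph : ℕ → Graph
    graph K = mkGraph (suc K) (cycleEdges K ++ List.map (λ k → K , n * k) (List.upTo m))

  k*n<N : ∀ {k} → k < m → k * n < N
  k*n<N = *-monoˡ-< n

  length-allEdges : length allEdges ≡ N + m
  length-allEdges = trans (length-++ (applyUpTo rimEdge N))
    (cong₂ _+_ (length-applyUpTo rimEdge N) (length-applyUpTo spokeEdge m))

  allEdges-below : EdgesBelow (suc N) allEdges
  allEdges-below = All.++⁺
    (All.applyUpTo⁺₁ rimEdge N (λ {i} i<N → m≤n⇒m≤1+n i<N , m≤n⇒m≤1+n (m%n<n (suc i) N)))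
    (All.applyUpTo⁺₁ spokeEdge m (λ k<m → ≤-refl , m≤n⇒m≤1+n (k*n<N k<m)))

  select-allEdges : (w : Vec Bool N) (t : Vec Bool m) → select allEdges (w Vec.++ t) ≡
    select (applyUpTo rimEdge N) w ++ select (applyUpTo spokeEdge m) t
  select-allEdges w t = select-++ _ _ w t (length-applyUpTo rimEdge N)

  module _ (us : Vec (Vec Bool n) m) (t : Vec Bool m) where

    chosen : List Edge
    chosen = select allEdges (Vec.concat us Vec.++ t)

    chosen-All : ∀ {Q : Edge → Set} →
      All Q (select (applyUpTo rimEdge N) (Vec.concat us)) →
      All Q (select (applyUpTo spokeEdge m) t) → All Q chosen
    chosen-All qr qs = subst (All _) (sym (select-allEdges (Vec.concat us) t)) (All.++⁺ qr qs)

    scan⇒connected : T (scan (before false) (Vec.map falses us) t) → T (isConnected (suc N) chosen)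
    scan⇒connected acc = walk⇒isConnected (select-All (Vec.concat us Vec.++ t) allEdges-below) walks
      where
      members : All (_∈ chosen) (select (applyUpTo rimEdge N) (Vec.concat us)) ×
                All (_∈ chosen) (select (applyUpTo spokeEdge m) t)
      members = All.++⁻ (select (applyUpTo rimEdge N) (Vec.concat us))
        (subst (All (_∈ chosen)) (select-allEdges (Vec.concat us) t) (All.tabulate id))
      at : ∀ {x y z} → x < N → (x , y) ∈ chosen → y ≡ z → Walk chosen (x % N) z
      at x<N e refl = subst (λ x → Walk chosen x _) (sym (m<n⇒m%n≡m x<N)) (Eq.return e)
      reached : Reached chosen 0 N (before false) × (∀ p → p ≤ N → Walk chosen (p % N) N)
      reached = scan-reaches us t (_% N) (before false)
        (All⇒Linked (Vec.concat us) (λ p p<N e → at p<N e refl) (proj₁ members))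
        (All⇒Marked t (λ k k<m e → subst (λ x → Walk chosen x N) (sym (m<n⇒m%n≡m (k*n<N k<m)))
                                     (walk-sym (Eq.return e))) (proj₂ members))
        (stop , λ ()) (n%n≡0 N) acc
      0~N : Walk chosen 0 N
      0~N = proj₂ (proj₁ reached)
      walks : ∀ {v} → v < suc N → Walk chosen 0 v
      walks v<1+N with m≤n⇒m<n∨m≡n (≤-pred v<1+N)
      ... | inj₂ refl = 0~N
      ... | inj₁ v<N  = 0~N ◅◅ walk-sym
        (subst (λ x → Walk chosen x N) (m<n⇒m%n≡m v<N) (proj₂ reached _ (<⇒≤ v<N)))

    connected⇒scan : T (isConnected (suc N) chosen) → T (scan (before false) (Vec.map falses us) t)
    connected⇒scan conn with scan (before false) (Vec.map falses us) t in rej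
    ... | true  = tt
    ... | false with scan-colours us t (before false) rej
    ...   | _ , χ , (lus , mt , end) , (x≡χ0 , _) , inj₂ (p , p≤N , χp≡false) = case false≡true of λ ()
      where
      -- Position N of the scan is rim vertex 0 again, whereas vertex N of the graph is the centre,
      -- so `χ N` must be overridden. `κ` is constant along chosen edges, `true` at the centre and
      -- `false` at some rim vertex.
      κ : ℕ → Bool
      κ v = if does (v ≟ N) then true else χ v
      κ-centre : κ N ≡ true
      κ-centre = cong (λ b → if b then true else χ N) (dec-true (N ≟ N) refl)
      κ-rim : ∀ {v} → v < N → κ v ≡ χ v
      κ-rim {v} v<N = cong (λ b → if b then true else χ v) (dec-false (v ≟ N) (<⇒≢ v<N))
      κ-% : ∀ {p} → p ≤ N → κ (p % N) ≡ χ p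
      κ-% p≤N with m≤n⇒m<n∨m≡n p≤N
      ... | inj₁ p<N  = trans (cong κ (m<n⇒m%n≡m p<N)) (κ-rim p<N)
      ... | inj₂ refl = trans (cong κ (n%n≡0 N)) (trans (κ-rim (s≤s z≤n)) (sym (trans end x≡χ0)))
      proper : All (λ e → κ (proj₁ e) ≡ κ (proj₂ e)) chosen
      proper = chosen-All
        (Linked⇒All (Vec.concat us) (λ p p<N eq → trans (κ-rim p<N) (trans eq (sym (κ-% p<N)))) lus)
        (Marked⇒All t (λ k k<m χt → trans κ-centre
          (sym (trans (κ-rim (k*n<N k<m)) (Equivalence.to T-≡ χt)))) mt)
      κ-walk : ∀ {u v} → Walk chosen u v → κ u ≡ κ v
      κ-walk = Eq.gfold isEquivalence κ (All.lookup proper)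
      ends : ∀ {v} → v < suc N → κ 0 ≡ κ v
      ends v< = κ-walk (isConnected⇒walk (suc N) chosen conn v<)
      false≡true : false ≡ true
      false≡true = begin
        false     ≡⟨ χp≡false ⟨
        χ p       ≡⟨ κ-% p≤N ⟨
        κ (p % N) ≡⟨ ends (m≤n⇒m≤1+n (m%n<n p N)) ⟨
        κ 0       ≡⟨ ends ≤-refl ⟩
        κ N       ≡⟨ κ-centre ⟩
        true ∎
        where open ≡-Reasoning

    isConnected≡scan : isConnected (suc N) chosen ≡ scan (before false) (Vec.map falses us) t
    isConnected≡scan = T-ext connected⇒scan scan⇒connected

  isSpanningTree≡isWheelTree : ∀ us t →
    isSpanningTree (suc N) (chosen us t) ≡ isWheelTree (Vec.map falses us) t
  isSpanningTree≡isWheelTree us t = begin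
    isSpanningTree (suc N) (chosen us t)
      ≡⟨ isSpanningTree-minimal (select-All (Vec.concat us Vec.++ t) allEdges-below) ⟩
    isConnected (suc N) (chosen us t) ∧
      all (disconnected ∘ proj₂) (picks (chosen us t))
      ≡⟨ cong₂ _∧_ (isConnected≡scan us t)
           (all-picks-select disconnected allEdges (Vec.concat us Vec.++ t) length-allEdges) ⟩
    scan (before false) (Vec.map falses us) t ∧
      allFlips (disconnected ∘ select allEdges) (Vec.concat us Vec.++ t)
      ≡⟨ cong (scan (before false) (Vec.map falses us) t ∧_)
           (trans (allFlips-++ (disconnected ∘ select allEdges) (Vec.concat us) t)
             (cong₂ _∧_ rims (allFlips-cong (λ t′ → cong not (isConnected≡scan us t′)) t))) ⟩
    isWheelTree (Vec.map falses us) t ∎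
    where
    open ≡-Reasoning
    disconnected : List Edge → Bool
    disconnected = not ∘ isConnected (suc N)
    rims : allFlips (λ w → disconnected (select allEdges (w Vec.++ t))) (Vec.concat us) ≡
           allRaises (λ c → not (scan (before false) c t)) (Vec.map falses us)
    rims = allFlips-blocks _ _ (λ us′ → cong not (isConnected≡scan us′ t))
      (λ c 2≤ → cong not (scan-2≤ (before false) c t 2≤)) us

  σ-Jahangir : σ (Jahangir n m) ≡ weightedSum n m wheelTrees
  σ-Jahangir = begin
    σ (Jahangir n m)
      ≡⟨ cong σ Jahangir≡ ⟩
    length (List.filter (T? ∘ isSpanningTree (suc N)) (sublists allEdges))
      ≡⟨ count-sublists (isSpanningTree (suc N)) allEdges length-allEdges ⟩
    sumBits (N + m) treeAt
      ≡⟨ sumBits-++ N treeAt ⟩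
    sumBits N (λ w → sumBits m (λ t → treeAt (w Vec.++ t)))
      ≡⟨ sumBits-concat n m (λ w → sumBits m (λ t → treeAt (w Vec.++ t))) ⟩
    sumBlocks n m (λ us → sumBits m (λ t → treeAt (Vec.concat us Vec.++ t)))
      ≡⟨ sumBlocks-cong n m (λ us → sumBits-cong m (λ t →
           cong indicator (isSpanningTree≡isWheelTree us t))) ⟩
    sumBlocks n m (wheelTrees ∘ Vec.map falses)
      ≡⟨ sumBlocks-falses n m wheelTrees wheelTrees-2≤ ⟩
    weightedSum n m wheelTrees ∎
    where
    open ≡-Reasoning
    treeAt : Vec Bool (N + m) → ℕ
    treeAt b = indicator (isSpanningTree (suc N) (select allEdges b))

-- The limit

-- Carried out on unnormalised rationals, where no reduction of fractions interferes with the
-- numerators.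
ratio-1 : ∀ b d → ratio (suc b + d) (suc b) - 1ℚ ≡ ratio d (suc b)
ratio-1 b d = ℚ.toℚᵘ-injective (begin
  toℚᵘ (ratio (suc b + d) (suc b) - 1ℚ)
    ≈⟨ ℚ.toℚᵘ-homo-+ (ratio (suc b + d) (suc b)) (ℚ.- 1ℚ) ⟩
  toℚᵘ (ratio (suc b + d) (suc b)) ℚᵘ.+ toℚᵘ (ℚ.- 1ℚ)
    ≈⟨ ℚᵘ.+-congˡ (toℚᵘ (ℚ.- 1ℚ)) (ℚ.toℚᵘ-fromℚᵘ (mkℚᵘ (ℤ.+ (suc b + d)) b)) ⟩
  mkℚᵘ (ℤ.+ (suc b + d)) b ℚᵘ.+ toℚᵘ (ℚ.- 1ℚ)
    ≈⟨ ℚᵘ.*≡* numerators ⟩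
  mkℚᵘ (ℤ.+ d) b
    ≈⟨ ℚ.toℚᵘ-fromℚᵘ (mkℚᵘ (ℤ.+ d) b) ⟨
  toℚᵘ (ratio d (suc b)) ∎)
  where
  open ℚᵘ.≃-Reasoning
  numerators : ((ℤ.+ (suc b + d)) ℤ.* ℤ.+ 1 ℤ.+ (ℤ.- ℤ.+ 1) ℤ.* ℤ.+ suc b) ℤ.* ℤ.+ suc b
               ≡ (ℤ.+ d) ℤ.* ℤ.+ (suc b * 1)
  numerators = cong₂ ℤ._*_
    (trans (cong₂ ℤ._+_ (ℤ.*-identityʳ (ℤ.+ (suc b + d))) (ℤ.-1*i≡-i (ℤ.+ suc b)))
      (trans (cong (ℤ._+ (ℤ.- ℤ.+ suc b)) (ℤ.+-comm (ℤ.+ suc b) (ℤ.+ d)))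
        (trans (ℤ.+-assoc (ℤ.+ d) (ℤ.+ suc b) (ℤ.- ℤ.+ suc b))
          (trans (cong (ℤ._+_ (ℤ.+ d)) (ℤ.+-inverseʳ (ℤ.+ suc b))) (ℤ.+-identityʳ (ℤ.+ d))))))
    (cong ℤ.+_ (sym (*-identityʳ (suc b))))

-- A positive ε with denominator f has numerator at least 1, so ε ≥ 1/f, and the bound on d says
-- that d / (b + 1) < 1/f.
ratio-< : ∀ {ε} b d → 0ℚ <ℚ ε → d * ℚ.↧ₙ ε < suc b → ratio d (suc b) <ℚ ε
ratio-< {mkℚ (ℤ.+ suc e) f _} b d _ lt = ℚ.toℚᵘ-cancel-<
  (ℚᵘ.<-respˡ-≃ (ℚᵘ.≃-sym (ℚ.toℚᵘ-fromℚᵘ (mkℚᵘ (ℤ.+ d) b)))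
    (ℚᵘ.*<* (subst₂ ℤ._<_ (ℤ.pos-* d (suc f)) (ℤ.pos-* (suc e) (suc b))
      (ℤ.+<+ (≤-trans lt (m≤m+n (suc b) (e * suc b)))))))
ratio-< {mkℚ (ℤ.+ zero) f _}   b d (ℚ.*<* (ℤ.+<+ ())) _
ratio-< {mkℚ (ℤ.-[1+ _ ]) f _} b d (ℚ.*<* ()) _

0≤ratio : ∀ d b → 0ℚ ℚ.≤ ratio d (suc b)
0≤ratio d b = ℚ.toℚᵘ-cancel-≤ (ℚᵘ.≤-respʳ-≃ (ℚᵘ.≃-sym (ℚ.toℚᵘ-fromℚᵘ (mkℚᵘ (ℤ.+ d) b)))
  (ℚᵘ.nonNegative⁻¹ (mkℚᵘ (ℤ.+ d) b)))

-- With d = a - b the growth bound becomes pd ≤ gb, so d/b ≤ g/p, and this is below 1/f for f the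
-- denominator of ε because gf < p.
ratio-close : ∀ {ε} p g a b → 0ℚ <ℚ ε → g * ℚ.↧ₙ ε < p → 1 ≤ b → b ≤ a →
  p * a ≤ (p + g) * b → ∣ ratio a b - 1ℚ ∣ <ℚ ε
ratio-close {ε} p g a (suc b) 0<ε large _ b≤a grow =
  subst (λ x → ∣ ratio x (suc b) - 1ℚ ∣ <ℚ ε) (m+[n∸m]≡n b≤a)
    (subst (_<ℚ ε) (sym (trans (cong ∣_∣ (ratio-1 b d)) (ℚ.0≤p⇒∣p∣≡p (0≤ratio d b))))
      (ratio-< b d 0<ε small))
  where
  open ≤-Reasoning
  d f : ℕ
  d = a ∸ suc b
  f = ℚ.↧ₙ ε
  excess : p * d ≤ g * suc b
  excess = +-cancelˡ-≤ (p * suc b) (p * d) (g * suc b) (begin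
    p * suc b + p * d  ≡⟨ *-distribˡ-+ p (suc b) d ⟨
    p * (suc b + d)    ≡⟨ cong (p *_) (m+[n∸m]≡n b≤a) ⟩
    p * a              ≤⟨ grow ⟩
    (p + g) * suc b    ≡⟨ *-distribʳ-+ (suc b) p g ⟩
    p * suc b + g * suc b ∎)
  swap : ∀ g b f → g * b * f ≡ g * f * b
  swap = solve-∀
  small : d * f < suc b
  small = *-cancelˡ-< p (d * f) (suc b) (begin-strict
    p * (d * f)      ≡⟨ *-assoc p d f ⟨
    p * d * f        ≤⟨ *-monoˡ-≤ f excess ⟩
    g * suc b * f    ≡⟨ swap g (suc b) f ⟩
    g * f * suc b    <⟨ *-monoˡ-< (suc b) large ⟩
    p * suc b ∎)

wheelTrees-star : ∀ m → 1 ≤ wheelTrees (ones (suc m))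
wheelTrees-star m = ≤-trans
  (≤-reflexive (cong indicator (sym (isWheelTree-star m))))
  (sumBits-≥-all-true (suc m) (indicator ∘ isWheelTree (ones (suc m))))

theorem3p1 : (m : ℕ) → 2 < m →
    (ε : ℚ) → 0ℚ <ℚ ε →
    ∃[ N ] ((n : ℕ) → N ≤ n → 3 ≤ n →
    ∣ ratio (σ (Jahangir n m)) (σ (Jahangir (n ∸ 1) m)) - 1ℚ ∣ <ℚ ε)
theorem3p1 (suc m) _ ε 0<ε = 2 + growth (suc m) * ℚ.↧ₙ ε , close
  where
  close : ∀ n → 2 + growth (suc m) * ℚ.↧ₙ ε ≤ n → 3 ≤ n →
    ∣ ratio (σ (Jahangir n (suc m))) (σ (Jahangir (n ∸ 1) (suc m))) - 1ℚ ∣ <ℚ ε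
  -- `ratio-close` is used at n - 1, here `suc p`, which must exceed `growth (suc m) * ℚ.↧ₙ ε`; this
  -- explains the 2 in the threshold.
  close (suc (suc p)) (s≤s large) _ =
    subst₂ (λ a b → ∣ ratio a b - 1ℚ ∣ <ℚ ε)
      (sym (Subdivided.σ-Jahangir (suc p) m)) (sym (Subdivided.σ-Jahangir p m))
      (ratio-close (suc p) (growth (suc m)) _ _ 0<ε large
        (≤-trans (wheelTrees-star m) (weightedSum-≥-all-one (suc p) (suc m) wheelTrees (s≤s z≤n)))
        (weightedSum-≤-suc (suc p) (suc m) wheelTrees)
        (weightedSum-growth (suc p) (suc m) wheelTrees (s≤s z≤n)))
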